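{- If $\pi$ is a permutation which contains the pattern $231$ but contains no copy of the Fishburn pattern $f$, then $\pi$ contains the pattern $3142$.
   Context: Permutations of $\{1,\dots,n\}$ are written in one-line notation $\pi=\pi_1\cdots\pi_n$. A permutation $\pi$ contains a (classical) pattern $\sigma$ if some subsequence of $\pi$ has the same length and relative order as $\sigma$; otherwise $\pi$ avoids $\sigma$. A copy of the Fishburn pattern $f$ in $\pi$ is a subsequence $\pi_j,\pi_{j+1},\pi_k$ with $j+1<k$, $\pi_j=\pi_k+1$, and $\pi_{j+1}>\pi_j$. -}

module Defs where

open import Data.Nat.Base using (ℕ; suc)
open import Data.Fin.Base using (Fin; toℕ; _<_)
open import Data.Fin.Patterns using (0F; 1F; 2F; 3F)
open import Data.Fin.Permutation using (Permutation′; permutation; _⟨$⟩ʳ_)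
open import Data.Product.Base using (∃; ∃-syntax; _×_)
open import Data.Vec.Base using (_∷_; []; lookup)
open import Function.Bundles using (_⇔_)
open import Relation.Binary.PropositionalEquality.Core using (_≡_; refl)

private
  variable
    k n : ℕ

-- Permutations of {1, …, n} are represented on Fin n = {0, …, n − 1}:
-- positions and values are both shifted down by one, and π ⟨$⟩ʳ i is the
-- letter of the one-line notation at position i.

-- The map e lists the positions, from left to right, of the chosen subsequence.
IsOccurrence : Permutation′ k → Permutation′ n → (Fin k → Fin n) → Set
IsOccurrence σ π e =
  (∀ a b → a < b → e a < e b) ×
  (∀ a b → (σ ⟨$⟩ʳ a) < (σ ⟨$⟩ʳ b) ⇔ (π ⟨$⟩ʳ e a) < (π ⟨$⟩ʳ e b))

infix 4 _Contains_

_Contains_ : Permutation′ n → Permutation′ k → Set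
π Contains σ = ∃ λ e → IsOccurrence σ π e

-- In each pattern the first vector is the one-line notation (shifted down by
-- one) and the second is that of the inverse permutation.

pattern-231 : Permutation′ 3
pattern-231 = permutation
  (lookup (1F ∷ 2F ∷ 0F ∷ []))
  (lookup (2F ∷ 0F ∷ 1F ∷ []))
  (λ { 0F → refl ; 1F → refl ; 2F → refl })
  (λ { 0F → refl ; 1F → refl ; 2F → refl })

pattern-3142 : Permutation′ 4
pattern-3142 = permutation
  (lookup (2F ∷ 0F ∷ 3F ∷ 1F ∷ []))
  (lookup (1F ∷ 3F ∷ 0F ∷ 2F ∷ []))
  (λ { 0F → refl ; 1F → refl ; 2F → refl ; 3F → refl })
  (λ { 0F → refl ; 1F → refl ; 2F → refl ; 3F → refl })

-- The position j′ is j + 1; it is named because j + 1 must itself be a position.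
IsFishburnCopy : Permutation′ n → Fin n → Fin n → Fin n → Set
IsFishburnCopy π j j′ k =
  toℕ j′ ≡ suc (toℕ j) ×
  j′ < k ×
  toℕ (π ⟨$⟩ʳ j) ≡ suc (toℕ (π ⟨$⟩ʳ k)) ×
  (π ⟨$⟩ʳ j) < (π ⟨$⟩ʳ j′)

ContainsFishburn : Permutation′ n → Set
ContainsFishburn π = ∃[ j ] ∃[ j′ ] ∃[ k ] IsFishburnCopy π j j′ k

{-# OPTIONS --safe #-}
-- First shrink the given copy of 231: among the values from the "1" up to the
-- "2" some two consecutive ones v, v + 1 change sides of the position b of
-- the "3", so one may assume that the "2" at position a and the "1" at
-- position c carry consecutive values.  Since there is no Fishburn copy at
-- a, a + 1, c, the value at a + 1 is below the one at a, hence also below the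
-- one at c, and a, a + 1, b, c is a copy of 3142.
module Submission where

open import Defs
open import Data.Nat.Base as ℕ using (ℕ; zero; suc; z<s; s<s)
import Data.Nat.Properties as ℕ
open import Data.Fin.Base using (Fin; zero; suc; toℕ; fromℕ<; inject₁; _<_)
open import Data.Fin.Patterns using (0F; 1F; 2F; 3F)
open import Data.Fin.Permutation using (Permutation′; _⟨$⟩ʳ_; _⟨$⟩ˡ_; inverseˡ; inverseʳ)
open import Data.Fin.Properties using (<-cmp; <-trans; <-asym; <-irrefl; toℕ<n; toℕ-fromℕ<; toℕ-injective)
open import Data.Product.Base using (∃-syntax; _×_; _,_)
open import Data.Vec.Base using (_∷_; []; lookup)
open import Function.Base using (_∘_)
open import Function.Bundles using (mk⇔; Equivalence)
open import Relation.Binary.Definitions using (tri<; tri≈; tri>)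
open import Relation.Binary.PropositionalEquality.Core using (_≡_; sym; trans; cong; subst; subst₂)
open import Relation.Nullary.Negation.Core using (¬_; contradiction)

private
  variable
    k n : ℕ

⟨$⟩ʳ-injective : (π : Permutation′ n) → ∀ {x y} → π ⟨$⟩ʳ x ≡ π ⟨$⟩ʳ y → x ≡ y
⟨$⟩ʳ-injective π eq = trans (sym (inverseˡ π)) (trans (cong (π ⟨$⟩ˡ_) eq) (inverseˡ π))

StrictlyIncreasing : (Fin k → Fin n) → Set
StrictlyIncreasing f = ∀ x y → x < y → f x < f y

steps⇒increasing : (f : Fin (suc k) → Fin n) →
  (∀ i → f (inject₁ i) < f (suc i)) → StrictlyIncreasing f
steps⇒increasing {suc k} f step zero    (suc zero)    _         = step zero
steps⇒increasing {suc k} f step zero    (suc (suc y)) _         =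
  <-trans (step zero) (steps⇒increasing (f ∘ suc) (step ∘ suc) zero (suc y) z<s)
steps⇒increasing {suc k} f step (suc x) (suc y)       (s<s x<y) =
  steps⇒increasing (f ∘ suc) (step ∘ suc) x y x<y

-- Reading the entries by increasing value, through the inverse of `σ`, makes order isomorphism a
-- second monotonicity condition, so `steps⇒increasing` can settle both from adjacent pairs. The
-- converse implication follows by trichotomy.
increasing⇒occurrence : (σ : Permutation′ k) (π : Permutation′ n) (e : Fin k → Fin n) →
  StrictlyIncreasing e → StrictlyIncreasing (λ v → π ⟨$⟩ʳ e (σ ⟨$⟩ˡ v)) →
  IsOccurrence σ π e
increasing⇒occurrence σ π e e-inc v-inc = e-inc , λ a b → mk⇔ (to a b) (from a b)
  where
  to : ∀ a b → (σ ⟨$⟩ʳ a) < (σ ⟨$⟩ʳ b) → (π ⟨$⟩ʳ e a) < (π ⟨$⟩ʳ e b)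
  to a b σa<σb = subst₂ (λ x y → (π ⟨$⟩ʳ e x) < (π ⟨$⟩ʳ e y)) (inverseˡ σ) (inverseˡ σ)
    (v-inc (σ ⟨$⟩ʳ a) (σ ⟨$⟩ʳ b) σa<σb)

  from : ∀ a b → (π ⟨$⟩ʳ e a) < (π ⟨$⟩ʳ e b) → (σ ⟨$⟩ʳ a) < (σ ⟨$⟩ʳ b)
  from a b πa<πb with <-cmp (σ ⟨$⟩ʳ a) (σ ⟨$⟩ʳ b)
  ... | tri< σa<σb _ _ = σa<σb
  ... | tri> _ _ σb<σa = contradiction πa<πb (<-asym (to b a σb<σa))
  ... | tri≈ _ σa≡σb _ = contradiction πa<πb (<-irrefl (cong (λ x → π ⟨$⟩ʳ e x) (⟨$⟩ʳ-injective σ σa≡σb)))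

module _ (π : Permutation′ n) where

  -- Induction on `d`, the number of values strictly between those at `c` and `a`; the position `b`
  -- stays fixed throughout.
  consecutive-values-around : ∀ d a {b} c → a < b → b < c →
    toℕ (π ⟨$⟩ʳ a) ≡ suc (d ℕ.+ toℕ (π ⟨$⟩ʳ c)) → (π ⟨$⟩ʳ a) < (π ⟨$⟩ʳ b) →
    ∃[ a′ ] ∃[ c′ ] a′ < b × b < c′ ×
      toℕ (π ⟨$⟩ʳ a′) ≡ suc (toℕ (π ⟨$⟩ʳ c′)) × (π ⟨$⟩ʳ a′) < (π ⟨$⟩ʳ b)
  consecutive-values-around zero    a c a<b b<c πa≡ πa<πb =
    a , c , a<b , b<c , πa≡ , πa<πb
  consecutive-values-around (suc d) a {b} c a<b b<c πa≡ πa<πb = go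
    where
    v<πa : suc (toℕ (π ⟨$⟩ʳ c)) ℕ.< toℕ (π ⟨$⟩ʳ a)
    v<πa = subst (suc (toℕ (π ⟨$⟩ʳ c)) ℕ.<_) (sym πa≡)
      (ℕ.s≤s (ℕ.s≤s (ℕ.m≤n+m (toℕ (π ⟨$⟩ʳ c)) d)))

    v<n : suc (toℕ (π ⟨$⟩ʳ c)) ℕ.< n
    v<n = ℕ.<-trans v<πa (toℕ<n (π ⟨$⟩ʳ a))

    -- The position of the value just above the one at `c`. As that value is below the one at `b`,
    -- `w` lies strictly on one side of `b`.
    w : Fin n
    w = π ⟨$⟩ˡ fromℕ< v<n

    πw≡ : toℕ (π ⟨$⟩ʳ w) ≡ suc (toℕ (π ⟨$⟩ʳ c))
    πw≡ = trans (cong toℕ (inverseʳ π)) (toℕ-fromℕ< v<n)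

    πw<πb : (π ⟨$⟩ʳ w) < (π ⟨$⟩ʳ b)
    πw<πb = subst (ℕ._< toℕ (π ⟨$⟩ʳ b)) (sym πw≡) (ℕ.<-trans v<πa πa<πb)

    go : _
    go with <-cmp w b
    ... | tri< w<b _ _ = w , c , w<b , b<c , πw≡ , πw<πb
    ... | tri≈ _ w≡b _ = contradiction πw<πb (<-irrefl (cong (π ⟨$⟩ʳ_) w≡b))
    -- To the right of `b`, `w` replaces `c` as the "1", and the gap shrinks by one.
    ... | tri> _ _ b<w = consecutive-values-around d a w a<b b<w
      (trans πa≡ (cong suc (trans (sym (ℕ.+-suc d _)) (cong (d ℕ.+_) (sym πw≡))))) πa<πb

  occurrence-3142 : ∀ {a b c d} → a < b → b < c → c < d →
    (π ⟨$⟩ʳ b) < (π ⟨$⟩ʳ d) → (π ⟨$⟩ʳ d) < (π ⟨$⟩ʳ a) → (π ⟨$⟩ʳ a) < (π ⟨$⟩ʳ c) →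
    π Contains pattern-3142
  occurrence-3142 {a} {b} {c} {d} a<b b<c c<d πb<πd πd<πa πa<πc =
    e , increasing⇒occurrence pattern-3142 π e
      (steps⇒increasing e λ { 0F → a<b ; 1F → b<c ; 2F → c<d })
      -- By increasing value the positions read `b`, `d`, `a`, `c`.
      (steps⇒increasing _ λ { 0F → πb<πd ; 1F → πd<πa ; 2F → πa<πc })
    where
    e : Fin 4 → Fin n
    e = lookup (a ∷ b ∷ c ∷ d ∷ [])

  consecutive-231⇒3142 : ¬ ContainsFishburn π → ∀ a b c → a < b → b < c →
    toℕ (π ⟨$⟩ʳ a) ≡ suc (toℕ (π ⟨$⟩ʳ c)) → (π ⟨$⟩ʳ a) < (π ⟨$⟩ʳ b) →
    π Contains pattern-3142
  consecutive-231⇒3142 noFishburn a b c a<b b<c πa≡ πa<πb = go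
    where
    -- The successor of `a` is a position because it is at most `b`.
    j<n : suc (toℕ a) ℕ.< n
    j<n = ℕ.≤-<-trans a<b (toℕ<n b)

    j : Fin n
    j = fromℕ< j<n

    j≡ : toℕ j ≡ suc (toℕ a)
    j≡ = toℕ-fromℕ< j<n

    a<j : a < j
    a<j = ℕ.≤-reflexive (sym j≡)

    j≤b : toℕ j ℕ.≤ toℕ b
    j≤b = subst (ℕ._≤ toℕ b) (sym j≡) a<b

    j<c : j < c
    j<c = ℕ.≤-<-trans j≤b b<c

    go : _
    go with <-cmp (π ⟨$⟩ʳ a) (π ⟨$⟩ʳ j)
    ... | tri< πa<πj _ _ = contradiction (a , j , c , j≡ , j<c , πa≡ , πa<πj) noFishburn
    ... | tri≈ _ πa≡πj _ = contradiction a<j (<-irrefl (⟨$⟩ʳ-injective π πa≡πj))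
    ... | tri> _ _ πj<πa = occurrence-3142 a<j j<b b<c πj<πc (ℕ.≤-reflexive (sym πa≡)) πa<πb
      where
      -- `j` cannot be `b`: its value is below the one at `a`, that of `b` above.
      j<b : j < b
      j<b = ℕ.≤∧≢⇒< j≤b λ eq →
        <-asym πa<πb (subst (λ x → (π ⟨$⟩ʳ x) < (π ⟨$⟩ʳ a)) (toℕ-injective eq) πj<πa)

      -- Being below the successor of the value at `c` gives only a weak inequality; injectivity and
      -- `j<c` make it strict.
      πj<πc : (π ⟨$⟩ʳ j) < (π ⟨$⟩ʳ c)
      πj<πc = ℕ.≤∧≢⇒< (ℕ.≤-pred (subst (toℕ (π ⟨$⟩ʳ j) ℕ.<_) πa≡ πj<πa))
        λ eq → <-irrefl (⟨$⟩ʳ-injective π (toℕ-injective eq)) j<c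

lemma2p1 : ∀ (n : ℕ) (π : Permutation′ n) → π Contains pattern-231 → ¬ ContainsFishburn π → π Contains pattern-3142
lemma2p1 n π (e , e-inc , e-iff) noFishburn =
  let πc<πa = Equivalence.to (e-iff 2F 0F) z<s
      πa<πb = Equivalence.to (e-iff 0F 1F) (s<s z<s)
      -- `πc<πa` unfolds to `suc` of one value being at most the other, so `d` is zero exactly when
      -- the two values are consecutive.
      d , eq = ℕ.m≤n⇒∃[o]m+o≡n πc<πa
      a , c , a<b , b<c , πa≡ , πa<πb′ = consecutive-values-around π d (e 0F) (e 2F)
        (e-inc 0F 1F z<s) (e-inc 1F 2F (s<s z<s))
        (trans (sym eq) (cong suc (ℕ.+-comm _ d))) πa<πb
  in consecutive-231⇒3142 π noFishburn a (e 1F) c a<b b<c πa≡ πa<πb′
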